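{- Let $m\geq 14$ be an integer. Then \[ \gamma_m\geq \begin{cases} 3m-12 &\text{if }m\not\equiv 2\pmod{3},\\ 2m-9&\text{if }m\equiv 2\pmod{3}. \end{cases} \]
   Context: $\mathbb{N}$ denotes the positive integers. For an integer $m\ge 3$ and $x\in\mathbb{Z}$, set $P_m(x):=\frac{(m-2)x^2-(m-4)x}{2}$. For $\ell\in\mathbb{N}$, $\boldsymbol{a}=(a_1,\dots,a_\ell)\in\mathbb{N}^{\ell}$ and $\boldsymbol{x}\in\mathbb{Z}^\ell$ set $P_{m,\boldsymbol{a}}(\boldsymbol{x}):=\sum_{j=1}^{\ell} a_j P_m(x_j)$. The form $P_{m,\boldsymbol{a}}$ represents $n$ if $P_{m,\boldsymbol{a}}(\boldsymbol{x})=n$ for some $\boldsymbol{x}\in\mathbb{Z}^\ell$, and it is universal if it represents every $n\in\mathbb{N}$. $\gamma_m$ denotes the minimal element of $\mathbb{N}$ with the property that, for every $\ell\in\mathbb{N}$ and every $\boldsymbol{a}\in\mathbb{N}^\ell$, $P_{m,\boldsymbol{a}}$ is universal if and only if it represents every positive integer $n\le\gamma_m$. (Such a $\gamma_m$ is known to exist.) -}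

module Defs where

open import Algebra.Properties.Monoid.Sum using (sum)
open import Data.Fin.Base using (Fin)
open import Data.Integer.Base using (ℤ; +_; _*_; _-_; _/ℕ_)
open import Data.Integer.Properties using (+-0-monoid)
open import Data.Nat.Base using (ℕ; _≤_)
open import Data.Product.Base using (_×_; ∃-syntax)
open import Data.Vec.Functional using (Vector)
open import Function.Bundles using (_⇔_)
open import Relation.Binary.PropositionalEquality using (_≡_)

-- The division is exact: (m - 2)x² - (m - 4)x = m(x² - x) - 2x² + 4x is even.
P : ℕ → ℤ → ℤ
P m x = ((+ m - + 2) * (x * x) - (+ m - + 4) * x) /ℕ 2

Pₐ : ∀ {ℓ} → ℕ → Vector ℕ ℓ → Vector ℤ ℓ → ℤ
Pₐ m a x = sum +-0-monoid (λ j → + a j * P m (x j))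

-- Positivity of ℓ, of the coefficients and of the represented integers is not
-- built into the types ℕ and Vector ℕ ℓ; it is always an explicit hypothesis 1 ≤ _.

Positive : ∀ {ℓ} → Vector ℕ ℓ → Set
Positive {ℓ} a = (j : Fin ℓ) → 1 ≤ a j

Represents : ∀ {ℓ} → ℕ → Vector ℕ ℓ → ℕ → Set
Represents {ℓ} m a n = ∃[ x ] Pₐ {ℓ} m a x ≡ + n

Universal : ∀ {ℓ} → ℕ → Vector ℕ ℓ → Set
Universal m a = ∀ n → 1 ≤ n → Represents m a n

DecidesUniversality : ℕ → ℕ → Set
DecidesUniversality m γ =
  ∀ ℓ → 1 ≤ ℓ → (a : Vector ℕ ℓ) → Positive a →
  Universal m a ⇔ (∀ n → 1 ≤ n → n ≤ γ → Represents m a n)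

-- γ_m as a relation: IsGamma m γ says that γ = γ_m.
IsGamma : ℕ → ℕ → Set
IsGamma m γ =
  1 ≤ γ × DecidesUniversality m γ ×
  (∀ k → 1 ≤ k → DecidesUniversality m k → γ ≤ k)

{-# OPTIONS --safe #-}
-- The bounds come from the forms with coefficients (1, 1, 3, …, 3), with k threes. Below 3m - 8
-- the only values of P_m are 0, 1, m - 3 and m, and 0, 1 alone give every n ≤ 3k + 2.
-- If n < 3m - 9 is represented, then the variables with coefficient 3 take values 0 and 1 only,
-- so n = y₀ + y₁ + 3T with T ≤ k and y₀, y₁ ∈ {0, 1, m - 3, m}. Reducing modulo 3:
--   m ≡ 0, k = m - 5:        n = 3m - 10 forces y₀ = y₁ = 1 and T = k + 1;
--   m ≡ 1, k = m - 5:        n = 3m - 12 forces y₀ = y₁ = 0 and T = k + 1;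
--   m ≡ 2, k = (2m - 13)/3:  n = 2m - 9 forces {y₀, y₁} = {0, 1} and T = k + 1.
-- In the last case 2m - 10 = 3k + 3 is still represented, as (m - 3) + 1 + (m - 8).
module Submission where

open import Defs
open import Data.Nat.Base using (ℕ; _≤_; _*_; _∸_; _%_)
open import Data.Product.Base using (_×_)
open import Relation.Binary.PropositionalEquality using (_≡_; _≢_)

open import Algebra.Properties.Monoid.Sum using (sum)
open import Data.Empty using (⊥)
open import Data.Fin.Base using (zero; suc)
open import Data.Integer.Base as ℤ using (ℤ; +_; -[1+_])
open import Data.Integer.Properties as ℤₚ using (+-0-monoid)
open import Data.Integer.Tactic.RingSolver as ℤ-Solver using ()
open import Data.Nat.Base using (zero; suc; _+_; _<_; _/_; z≤n; s≤s; s≤s⁻¹)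
open import Data.Nat.DivMod using (/-monoˡ-≤; m*n/n≡m; m≡m%n+[m/n]*n; m%n<n; [m+kn]%n≡m%n)
open import Data.Nat.Properties hiding (+-0-monoid)
open import Data.Nat.Tactic.RingSolver using (solve-∀)
open import Data.Product.Base using (_,_; ∃-syntax; -,_)
open import Data.Sum.Base using (_⊎_; inj₁; inj₂)
open import Data.Vec.Functional using (Vector; _∷_; []; replicate)
open import Function.Base using (_∘_)
open import Function.Bundles using (Equivalence)
open import Relation.Nullary using (¬_; contradiction)
open import Relation.Binary.PropositionalEquality using (refl; sym; trans; cong; cong₂; subst; module ≡-Reasoning)

-- Values of `P`

-- Throughout, m = 3 + r, so that m - 3 = r.

-- The constructors are named after the argument x at which the value is taken. At every other x the
-- value exceeds 3r = 3m - 9.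
data SmallValue (r : ℕ) : ℕ → Set where
  at-0  : SmallValue r 0
  at-1  : SmallValue r 1
  at-−1 : SmallValue r r
  at-2  : SmallValue r (3 + r)

-- Trades the division by 2 for a factor 2, so that each value becomes a polynomial identity for the
-- ring solver.
P-≡ : ∀ m x p → (+ m ℤ.- + 2) ℤ.* (x ℤ.* x) ℤ.- (+ m ℤ.- + 4) ℤ.* x ≡ + p ℤ.* + 2 → P m x ≡ + p
P-≡ m x p eq = begin
  P m x              ≡⟨ cong (λ z → z ℤ./ℕ 2) (trans eq (sym (ℤₚ.pos-* p 2))) ⟩
  + (p * 2 / 2)      ≡⟨ cong +_ (m*n/n≡m p 2) ⟩
  + p                ∎
  where open ≡-Reasoning

P-0 : ∀ r → P (3 + r) (+ 0) ≡ + 0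
P-0 r = P-≡ (3 + r) (+ 0) 0 (lemma (+ r))
  where
  lemma : ∀ R → (+ 3 ℤ.+ R ℤ.- + 2) ℤ.* (+ 0 ℤ.* + 0) ℤ.- (+ 3 ℤ.+ R ℤ.- + 4) ℤ.* + 0 ≡ + 0 ℤ.* + 2
  lemma = ℤ-Solver.solve-∀

P-1 : ∀ r → P (3 + r) (+ 1) ≡ + 1
P-1 r = P-≡ (3 + r) (+ 1) 1 (lemma (+ r))
  where
  lemma : ∀ R → (+ 3 ℤ.+ R ℤ.- + 2) ℤ.* (+ 1 ℤ.* + 1) ℤ.- (+ 3 ℤ.+ R ℤ.- + 4) ℤ.* + 1 ≡ + 1 ℤ.* + 2
  lemma = ℤ-Solver.solve-∀

P-−1 : ∀ r → P (3 + r) -[1+ 0 ] ≡ + r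
P-−1 r = P-≡ (3 + r) -[1+ 0 ] r (lemma (+ r))
  where
  lemma : ∀ R → (+ 3 ℤ.+ R ℤ.- + 2) ℤ.* (-[1+ 0 ] ℤ.* -[1+ 0 ]) ℤ.- (+ 3 ℤ.+ R ℤ.- + 4) ℤ.* -[1+ 0 ] ≡ R ℤ.* + 2
  lemma = ℤ-Solver.solve-∀

P-2 : ∀ r → P (3 + r) (+ 2) ≡ + (3 + r)
P-2 r = P-≡ (3 + r) (+ 2) (3 + r) (lemma (+ r))
  where
  lemma : ∀ R → (+ 3 ℤ.+ R ℤ.- + 2) ℤ.* (+ 2 ℤ.* + 2) ℤ.- (+ 3 ℤ.+ R ℤ.- + 4) ℤ.* + 2 ≡ (+ 3 ℤ.+ R) ℤ.* + 2
  lemma = ℤ-Solver.solve-∀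

-- For x = 3 + j and for x = - (2 + j), the triangular number (x² - x)/2 equals 3 + j (j + 5)/2.
half-j[5+j] : ∀ j → ∃[ d ] (j + d) * 2 ≡ j * (5 + j)
half-j[5+j] zero = 0 , refl
half-j[5+j] (suc j) with d , eq ← half-j[5+j] j = j + d + 2 , (begin
  (suc j + (j + d + 2)) * 2      ≡⟨ lhs j d ⟩
  (j + d) * 2 + (2 * j + 6)      ≡⟨ cong (_+ (2 * j + 6)) eq ⟩
  j * (5 + j) + (2 * j + 6)      ≡⟨ rhs j ⟩
  suc j * (5 + suc j)            ∎)
  where
  open ≡-Reasoning
  lhs : ∀ j d → (suc j + (j + d + 2)) * 2 ≡ (j + d) * 2 + (2 * j + 6)
  lhs = solve-∀
  rhs : ∀ j → j * (5 + j) + (2 * j + 6) ≡ suc j * (5 + suc j)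
  rhs = solve-∀

half-j[5+j]ℤ : ∀ j d → (j + d) * 2 ≡ j * (5 + j) → (+ j ℤ.+ + d) ℤ.* + 2 ≡ + j ℤ.* (+ 5 ℤ.+ + j)
half-j[5+j]ℤ j d eq = trans (sym (ℤₚ.pos-* (j + d) 2)) (trans (cong +_ eq) (ℤₚ.pos-* j (5 + j)))

-- P_m(x) = (m - 2)(x² - x)/2 + x. For x ≥ 3 the first term is at least 3 (r + 1), which already
-- exceeds 3r, and x only adds to it.
P-3+ : ∀ r j → ∃[ e ] P (3 + r) (+ (3 + j)) ≡ + (suc (3 * r) + e)
P-3+ r j with d , eq ← half-j[5+j] j =
  -, trans (P-≡ (3 + r) (+ (3 + j)) (3 + 3 * r + (r * (j + d) + (j + d) + (3 + j))) (begin
    (+ 3 ℤ.+ R ℤ.- + 2) ℤ.* ((+ 3 ℤ.+ J) ℤ.* (+ 3 ℤ.+ J)) ℤ.- (+ 3 ℤ.+ R ℤ.- + 4) ℤ.* (+ 3 ℤ.+ J)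
      ≡⟨ lhs R J ⟩
    (+ 1 ℤ.+ R) ℤ.* (J ℤ.* (+ 5 ℤ.+ J) ℤ.+ + 6) ℤ.+ + 2 ℤ.* (+ 3 ℤ.+ J)
      ≡⟨ cong (λ s → (+ 1 ℤ.+ R) ℤ.* (s ℤ.+ + 6) ℤ.+ + 2 ℤ.* (+ 3 ℤ.+ J)) (half-j[5+j]ℤ j d eq) ⟨
    (+ 1 ℤ.+ R) ℤ.* ((J ℤ.+ D) ℤ.* + 2 ℤ.+ + 6) ℤ.+ + 2 ℤ.* (+ 3 ℤ.+ J)
      ≡⟨ rhs R J D ⟩
    (+ 3 ℤ.+ + 3 ℤ.* R ℤ.+ (R ℤ.* (J ℤ.+ D) ℤ.+ (J ℤ.+ D) ℤ.+ (+ 3 ℤ.+ J))) ℤ.* + 2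
      -- Sums of `+_` terms reduce by computation but products do not, so the two products are
      -- converted explicitly.
      ≡⟨ cong₂ (λ a b → (+ 3 ℤ.+ a ℤ.+ (b ℤ.+ (J ℤ.+ D) ℤ.+ (+ 3 ℤ.+ J))) ℤ.* + 2)
               (ℤₚ.pos-* 3 r) (ℤₚ.pos-* r (j + d)) ⟨
    + (3 + 3 * r + (r * (j + d) + (j + d) + (3 + j))) ℤ.* + 2 ∎))
  (cong +_ (regroup (3 * r) (r * (j + d) + (j + d) + (3 + j))))
  where
  open ≡-Reasoning
  R = + r
  J = + j
  D = + d
  lhs : ∀ R J → (+ 3 ℤ.+ R ℤ.- + 2) ℤ.* ((+ 3 ℤ.+ J) ℤ.* (+ 3 ℤ.+ J)) ℤ.- (+ 3 ℤ.+ R ℤ.- + 4) ℤ.* (+ 3 ℤ.+ J)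
        ≡ (+ 1 ℤ.+ R) ℤ.* (J ℤ.* (+ 5 ℤ.+ J) ℤ.+ + 6) ℤ.+ + 2 ℤ.* (+ 3 ℤ.+ J)
  lhs = ℤ-Solver.solve-∀
  rhs : ∀ R J D → (+ 1 ℤ.+ R) ℤ.* ((J ℤ.+ D) ℤ.* + 2 ℤ.+ + 6) ℤ.+ + 2 ℤ.* (+ 3 ℤ.+ J)
        ≡ (+ 3 ℤ.+ + 3 ℤ.* R ℤ.+ (R ℤ.* (J ℤ.+ D) ℤ.+ (J ℤ.+ D) ℤ.+ (+ 3 ℤ.+ J))) ℤ.* + 2
  rhs = ℤ-Solver.solve-∀
  regroup : ∀ s t → 3 + s + t ≡ suc s + (2 + t)
  regroup = solve-∀

-- Here the linear term subtracts 2 + j. The summand j in j + d pays for it, so the excess over 3r +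
-- 1 is visibly a natural number. At x = -2 the excess is 0.
P-−[2+] : ∀ r j → ∃[ e ] P (3 + r) -[1+ suc j ] ≡ + (suc (3 * r) + e)
P-−[2+] r j with d , eq ← half-j[5+j] j =
  -, P-≡ (3 + r) -[1+ suc j ] (suc (3 * r) + (r * (j + d) + d)) (begin
    (+ 3 ℤ.+ R ℤ.- + 2) ℤ.* (ℤ.- (+ 2 ℤ.+ J) ℤ.* ℤ.- (+ 2 ℤ.+ J)) ℤ.- (+ 3 ℤ.+ R ℤ.- + 4) ℤ.* ℤ.- (+ 2 ℤ.+ J)
      ≡⟨ lhs R J ⟩
    (+ 1 ℤ.+ R) ℤ.* (J ℤ.* (+ 5 ℤ.+ J) ℤ.+ + 6) ℤ.- + 2 ℤ.* (+ 2 ℤ.+ J)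
      ≡⟨ cong (λ s → (+ 1 ℤ.+ R) ℤ.* (s ℤ.+ + 6) ℤ.- + 2 ℤ.* (+ 2 ℤ.+ J)) (half-j[5+j]ℤ j d eq) ⟨
    (+ 1 ℤ.+ R) ℤ.* ((J ℤ.+ D) ℤ.* + 2 ℤ.+ + 6) ℤ.- + 2 ℤ.* (+ 2 ℤ.+ J)
      ≡⟨ rhs R J D ⟩
    (+ 1 ℤ.+ + 3 ℤ.* R ℤ.+ (R ℤ.* (J ℤ.+ D) ℤ.+ D)) ℤ.* + 2
      ≡⟨ cong₂ (λ a b → (+ 1 ℤ.+ a ℤ.+ (b ℤ.+ D)) ℤ.* + 2) (ℤₚ.pos-* 3 r) (ℤₚ.pos-* r (j + d)) ⟨
    + (suc (3 * r) + (r * (j + d) + d)) ℤ.* + 2 ∎)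
  where
  open ≡-Reasoning
  R = + r
  J = + j
  D = + d
  lhs : ∀ R J → (+ 3 ℤ.+ R ℤ.- + 2) ℤ.* (ℤ.- (+ 2 ℤ.+ J) ℤ.* ℤ.- (+ 2 ℤ.+ J)) ℤ.- (+ 3 ℤ.+ R ℤ.- + 4) ℤ.* ℤ.- (+ 2 ℤ.+ J)
        ≡ (+ 1 ℤ.+ R) ℤ.* (J ℤ.* (+ 5 ℤ.+ J) ℤ.+ + 6) ℤ.- + 2 ℤ.* (+ 2 ℤ.+ J)
  lhs = ℤ-Solver.solve-∀
  rhs : ∀ R J D → (+ 1 ℤ.+ R) ℤ.* ((J ℤ.+ D) ℤ.* + 2 ℤ.+ + 6) ℤ.- + 2 ℤ.* (+ 2 ℤ.+ J)
        ≡ (+ 1 ℤ.+ + 3 ℤ.* R ℤ.+ (R ℤ.* (J ℤ.+ D) ℤ.+ D)) ℤ.* + 2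
  rhs = ℤ-Solver.solve-∀

P-value : ∀ r x → ∃[ p ] P (3 + r) x ≡ + p × (SmallValue r p ⊎ 3 * r < p)
P-value r (+ 0) = 0 , P-0 r , inj₁ at-0
P-value r (+ 1) = 1 , P-1 r , inj₁ at-1
P-value r (+ 2) = 3 + r , P-2 r , inj₁ at-2
P-value r (+ suc (suc (suc j))) with e , eq ← P-3+ r j =
  -, eq , inj₂ (m≤m+n (suc (3 * r)) e)
P-value r -[1+ 0 ] = r , P-−1 r , inj₁ at-−1
P-value r -[1+ suc j ] with e , eq ← P-−[2+] r j =
  -, eq , inj₂ (m≤m+n (suc (3 * r)) e)

-- A coarser dichotomy for the variables with coefficient 3: there a value of at least r contributes
-- at least 3r, too much for any n < 3r.
P-value-≤1-or-≥r : ∀ r x → ∃[ p ] P (3 + r) x ≡ + p × (p ≤ 1 ⊎ r ≤ p)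
P-value-≤1-or-≥r r x with P-value r x
... | p , eq , inj₂ 3r<p   = p , eq , inj₂ (≤-trans (m≤m+n r _) (<⇒≤ 3r<p))
... | _ , eq , inj₁ at-0  = _ , eq , inj₁ z≤n
... | _ , eq , inj₁ at-1  = _ , eq , inj₁ ≤-refl
... | _ , eq , inj₁ at-−1 = _ , eq , inj₂ ≤-refl
... | _ , eq , inj₁ at-2  = _ , eq , inj₂ (m≤n+m r 3)

-- Sums over the form (1, 1, 3, ..., 3)

1,1,3… : ∀ k → Vector ℕ (2 + k)
1,1,3… k = 1 ∷ 1 ∷ replicate k 3

1,1,3…-positive : ∀ k → Positive (1,1,3… k)
1,1,3…-positive k zero          = ≤-refl
1,1,3…-positive k (suc zero)    = ≤-refl
1,1,3…-positive k (suc (suc j)) = s≤s z≤n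

Σ3P : ∀ {k} → ℕ → Vector ℤ k → ℤ
Σ3P r xs = sum +-0-monoid (λ j → + 3 ℤ.* P (3 + r) (xs j))

3P+3T : ∀ {z} p T → z ≡ + p → + 3 ℤ.* z ℤ.+ + (T * 3) ≡ + ((p + T) * 3)
3P+3T p T refl = begin
  + 3 ℤ.* + p ℤ.+ + (T * 3) ≡⟨ cong (ℤ._+ + (T * 3)) (ℤₚ.pos-* 3 p) ⟨
  + (3 * p + T * 3)         ≡⟨ cong +_ (lemma p T) ⟩
  + ((p + T) * 3)           ∎
  where
  open ≡-Reasoning
  lemma : ∀ p T → 3 * p + T * 3 ≡ (p + T) * 3
  lemma = solve-∀

-- T arguments equal to 1, the others 0.
Σ3P-attains : ∀ r {k} T → T ≤ k → ∃[ xs ] Σ3P {k} r xs ≡ + (T * 3)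
Σ3P-attains r {zero}  zero    _ = [] , refl
Σ3P-attains r {suc k} zero    _ with xs , eq ← Σ3P-attains r {k} zero z≤n =
  + 0 ∷ xs , trans (cong (ℤ._+_ (+ 3 ℤ.* P (3 + r) (+ 0))) eq) (3P+3T 0 0 (P-0 r))
Σ3P-attains r {suc k} (suc T) (s≤s T≤k) with xs , eq ← Σ3P-attains r T T≤k =
  + 1 ∷ xs , trans (cong (ℤ._+_ (+ 3 ℤ.* P (3 + r) (+ 1))) eq) (3P+3T 1 T (P-1 r))

Σ3P-value : ∀ r {k} (xs : Vector ℤ k) → ∃[ T ] Σ3P r xs ≡ + (T * 3) × (T ≤ k ⊎ r ≤ T)
Σ3P-value r {zero}  xs = 0 , refl , inj₁ z≤n
Σ3P-value r {suc k} xs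
  with p , P≡p , p-bound ← P-value-≤1-or-≥r r (xs zero)
     | T , Σ≡T , T-bound ← Σ3P-value r (xs ∘ suc)
  = p + T , trans (cong (ℤ._+_ (+ 3 ℤ.* P (3 + r) (xs zero))) Σ≡T) (3P+3T p T P≡p) , bound p-bound T-bound
  where
  bound : p ≤ 1 ⊎ r ≤ p → T ≤ k ⊎ r ≤ T → p + T ≤ suc k ⊎ r ≤ p + T
  bound (inj₁ p≤1) (inj₁ T≤k) = inj₁ (+-mono-≤ p≤1 T≤k)
  bound (inj₂ r≤p) _          = inj₂ (≤-trans r≤p (m≤m+n p T))
  bound (inj₁ _)   (inj₂ r≤T) = inj₂ (≤-trans r≤T (m≤n+m T p))

Pₐ-1,1,3… : ∀ r k (x : Vector ℤ (2 + k)) y₀ y₁ T →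
  P (3 + r) (x zero) ≡ + y₀ → P (3 + r) (x (suc zero)) ≡ + y₁ →
  Σ3P r (λ j → x (suc (suc j))) ≡ + (T * 3) →
  Pₐ (3 + r) (1,1,3… k) x ≡ + (y₀ + (y₁ + T * 3))
Pₐ-1,1,3… r k x y₀ y₁ T e₀ e₁ eΣ =
  cong₂ ℤ._+_ (trans (ℤₚ.*-identityˡ _) e₀) (cong₂ ℤ._+_ (trans (ℤₚ.*-identityˡ _) e₁) eΣ)

represents : ∀ r k x₀ x₁ y₀ y₁ T → P (3 + r) x₀ ≡ + y₀ → P (3 + r) x₁ ≡ + y₁ → T ≤ k →
  Represents (3 + r) (1,1,3… k) (y₀ + (y₁ + T * 3))
represents r k x₀ x₁ y₀ y₁ T e₀ e₁ T≤k with xs , eΣ ← Σ3P-attains r T T≤k =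
  x₀ ∷ x₁ ∷ xs , Pₐ-1,1,3… r k (x₀ ∷ x₁ ∷ xs) y₀ y₁ T e₀ e₁ eΣ

-- Represented and missed integers

-- The variables with coefficient 3 supply 3 (n / 3), and the two with coefficient 1 supply the
-- remainder as 0 + 0, 0 + 1 or 1 + 1.
represents-≤3k+2 : ∀ r k n → n ≤ k * 3 + 2 → Represents (3 + r) (1,1,3… k) n
represents-≤3k+2 r k n n≤3k+2 =
  subst (Represents (3 + r) (1,1,3… k)) (sym n≡) (by-residue (n % 3) (m%n<n n 3))
  where
  n≡ : n ≡ n % 3 + n / 3 * 3
  n≡ = m≡m%n+[m/n]*n n 3
  n/3≤k : n / 3 ≤ k
  n/3≤k = s≤s⁻¹ (*-cancelʳ-< 3 (n / 3) (suc k) (begin-strict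
    n / 3 * 3  ≤⟨ m≤n+m _ (n % 3) ⟩
    n % 3 + n / 3 * 3 ≡⟨ n≡ ⟨
    n          ≤⟨ n≤3k+2 ⟩
    k * 3 + 2  <⟨ +-monoʳ-< (k * 3) ≤-refl ⟩
    k * 3 + 3  ≡⟨ +-comm (k * 3) 3 ⟩
    suc k * 3  ∎))
    where open ≤-Reasoning
  by-residue : ∀ c → c < 3 → Represents (3 + r) (1,1,3… k) (c + n / 3 * 3)
  by-residue 0 _ = represents r k (+ 0) (+ 0) 0 0 (n / 3) (P-0 r) (P-0 r) n/3≤k
  by-residue 1 _ = represents r k (+ 0) (+ 1) 0 1 (n / 3) (P-0 r) (P-1 r) n/3≤k
  by-residue 2 _ = represents r k (+ 1) (+ 1) 1 1 (n / 3) (P-1 r) (P-1 r) n/3≤k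
  by-residue (suc (suc (suc _))) (s≤s (s≤s (s≤s ())))

P-value-≤3r : ∀ r x → ∃[ y ] P (3 + r) x ≡ + y × (y ≤ 3 * r → SmallValue r y)
P-value-≤3r r x with P-value r x
... | y , eq , inj₁ small = y , eq , λ _ → small
... | y , eq , inj₂ 3r<y  = y , eq , λ y≤3r → contradiction 3r<y (≤⇒≯ y≤3r)

-- No summand exceeds n < 3r. Hence y₀ and y₁ are small values, and r ≤ T is excluded, which leaves
-- T ≤ k.
misses-below-3r : ∀ r k n → n < 3 * r →
  (∀ {y₀ y₁} T → T ≤ k → SmallValue r y₀ → SmallValue r y₁ → y₀ + (y₁ + T * 3) ≢ n) →
  ¬ Represents (3 + r) (1,1,3… k) n
misses-below-3r r k n n<3r no-small (x , Pₐ≡n)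
  with y₀ , e₀ , small₀ ← P-value-≤3r r (x zero)
     | y₁ , e₁ , small₁ ← P-value-≤3r r (x (suc zero))
     | T , eΣ , T-bound ← Σ3P-value r (λ j → x (suc (suc j)))
  = no-small T (T≤k T-bound) (small₀ (≤3r (m≤m+n y₀ _)))
      (small₁ (≤3r (≤-trans (m≤m+n y₁ _) (m≤n+m _ y₀)))) sum≡n
  where
  sum≡n : y₀ + (y₁ + T * 3) ≡ n
  sum≡n = ℤₚ.+-injective (trans (sym (Pₐ-1,1,3… r k x y₀ y₁ T e₀ e₁ eΣ)) Pₐ≡n)
  ≤3r : ∀ {y} → y ≤ y₀ + (y₁ + T * 3) → y ≤ 3 * r
  ≤3r y≤sum = ≤-trans (≤-trans y≤sum (≤-reflexive sum≡n)) (<⇒≤ n<3r)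
  T≤k : T ≤ k ⊎ r ≤ T → T ≤ k
  T≤k (inj₁ h)   = h
  T≤k (inj₂ r≤T) = contradiction n<3r (≤⇒≯ (begin
    3 * r                ≡⟨ *-comm 3 r ⟩
    r * 3                ≤⟨ *-monoˡ-≤ 3 r≤T ⟩
    T * 3                ≤⟨ ≤-trans (m≤n+m (T * 3) y₁) (m≤n+m _ y₀) ⟩
    y₀ + (y₁ + T * 3)    ≡⟨ sum≡n ⟩
    n                    ∎))
    where open ≤-Reasoning

-- Applied to numerals c and d, where both residues compute and an absurd pattern refutes the
-- equation.
residues-≡ : ∀ c d a b → c + a * 3 ≡ d + b * 3 → c % 3 ≡ d % 3
residues-≡ c d a b eq =
  trans (sym ([m+kn]%n≡m%n c a 3)) (trans (cong (_% 3) eq) ([m+kn]%n≡m%n d b 3))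

quotients-≡ : ∀ c a b → c + a * 3 ≡ c + b * 3 → a ≡ b
quotients-≡ c a b eq = *-cancelʳ-≡ a b 3 (+-cancelˡ-≡ c _ _ eq)

collect : ∀ c d u v T → (c + u * 3) + ((d + v * 3) + T * 3) ≡ (c + d) + (u + v + T) * 3
collect = solve-∀

-- For n = 3m - 10 and r = m - 3 this is n + 1 = 3r: the largest n to which `misses-below-3r`
-- applies.
n<3r-m≡0 : ∀ v → suc (2 + (v * 3 + 2) * 3) ≡ 3 * ((1 + v) * 3)
n<3r-m≡0 = solve-∀

-- m = 3 (2 + v), n = 3 m - 10
misses-m≡0 : ∀ v → ¬ Represents (3 + (1 + v) * 3) (1,1,3… (v * 3 + 1)) (2 + (v * 3 + 2) * 3)
misses-m≡0 v = misses-below-3r _ _ _ (≤-reflexive (n<3r-m≡0 v))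
  (λ T T≤k s₀ s₁ → impossible T T≤k (classify s₀) (classify s₁))
  where
  -- Since 3 divides r, the value 1 is the only small one that is not a multiple of 3.
  classify : ∀ {y} → SmallValue ((1 + v) * 3) y → y ≡ 1 ⊎ ∃[ u ] y ≡ 0 + u * 3
  classify at-0  = inj₂ (0 , refl)
  classify at-1  = inj₁ refl
  classify at-−1 = inj₂ (1 + v , refl)
  classify at-2  = inj₂ (2 + v , refl)
  impossible : ∀ {y₀ y₁} T → T ≤ v * 3 + 1 → y₀ ≡ 1 ⊎ (∃[ u ] y₀ ≡ 0 + u * 3) → y₁ ≡ 1 ⊎ (∃[ u ] y₁ ≡ 0 + u * 3) →
    y₀ + (y₁ + T * 3) ≡ 2 + (v * 3 + 2) * 3 → ⊥
  impossible T T≤k (inj₁ refl) (inj₁ refl) eq =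
    <-irrefl (quotients-≡ 2 T (v * 3 + 2) eq) (≤-<-trans T≤k (+-monoʳ-< (v * 3) ≤-refl))
  impossible T T≤k (inj₁ refl) (inj₂ (u , refl)) eq
    with () ← residues-≡ 1 2 (u + T) (v * 3 + 2) (trans (sym (collect 1 0 0 u T)) eq)
  impossible T T≤k (inj₂ (u , refl)) (inj₁ refl) eq
    with () ← residues-≡ 1 2 (u + 0 + T) (v * 3 + 2) (trans (sym (collect 0 1 u 0 T)) eq)
  impossible T T≤k (inj₂ (u , refl)) (inj₂ (w , refl)) eq
    with () ← residues-≡ 0 2 (u + w + T) (v * 3 + 2) (trans (sym (collect 0 0 u w T)) eq)

n<3r-m≡1 : ∀ v → suc ((v * 3 + 3) * 3) + 2 ≡ 3 * (1 + (1 + v) * 3)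
n<3r-m≡1 = solve-∀

-- m = 3 (2 + v) + 1, n = 3 m - 12
misses-m≡1 : ∀ v → ¬ Represents (3 + (1 + (1 + v) * 3)) (1,1,3… (v * 3 + 2)) ((v * 3 + 3) * 3)
misses-m≡1 v = misses-below-3r _ _ _ (≤-trans (m≤m+n _ 2) (≤-reflexive (n<3r-m≡1 v)))
  (λ T T≤k s₀ s₁ → impossible T T≤k (classify s₀) (classify s₁))
  where
  -- Here r ≡ 1 modulo 3, so every small value other than 0 is 1 modulo 3.
  classify : ∀ {y} → SmallValue (1 + (1 + v) * 3) y → y ≡ 0 ⊎ ∃[ u ] y ≡ 1 + u * 3
  classify at-0  = inj₁ refl
  classify at-1  = inj₂ (0 , refl)
  classify at-−1 = inj₂ (1 + v , refl)
  classify at-2  = inj₂ (2 + v , refl)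
  impossible : ∀ {y₀ y₁} T → T ≤ v * 3 + 2 → y₀ ≡ 0 ⊎ (∃[ u ] y₀ ≡ 1 + u * 3) → y₁ ≡ 0 ⊎ (∃[ u ] y₁ ≡ 1 + u * 3) →
    y₀ + (y₁ + T * 3) ≡ (v * 3 + 3) * 3 → ⊥
  impossible T T≤k (inj₁ refl) (inj₁ refl) eq =
    <-irrefl (quotients-≡ 0 T (v * 3 + 3) eq) (≤-<-trans T≤k (+-monoʳ-< (v * 3) ≤-refl))
  impossible T T≤k (inj₁ refl) (inj₂ (u , refl)) eq
    with () ← residues-≡ 1 0 (u + T) (v * 3 + 3) (trans (sym (collect 0 1 0 u T)) eq)
  impossible T T≤k (inj₂ (u , refl)) (inj₁ refl) eq
    with () ← residues-≡ 1 0 (u + 0 + T) (v * 3 + 3) (trans (sym (collect 1 0 u 0 T)) eq)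
  impossible T T≤k (inj₂ (u , refl)) (inj₂ (w , refl)) eq
    with () ← residues-≡ 2 0 (u + w + T) (v * 3 + 3) (trans (sym (collect 1 1 u w T)) eq)

n<3r-m≡2 : ∀ v → suc (1 + (v * 2 + 2) * 3) + (7 + v * 3) ≡ 3 * (2 + (1 + v) * 3)
n<3r-m≡2 = solve-∀

-- m = 3 (2 + v) + 2, n = 2 m - 9
misses-m≡2 : ∀ v → ¬ Represents (3 + (2 + (1 + v) * 3)) (1,1,3… (v * 2 + 1)) (1 + (v * 2 + 2) * 3)
misses-m≡2 v = misses-below-3r _ _ _ (≤-trans (m≤m+n _ (7 + v * 3)) (≤-reflexive (n<3r-m≡2 v)))
  (λ T T≤k s₀ s₁ → impossible T T≤k (classify s₀) (classify s₁))
  where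
  -- The last alternative covers r and r + 3. Its form keeps the lower bound r visible, because
  -- residues alone do not exclude two such values.
  Class : ℕ → Set
  Class y = y ≡ 0 ⊎ y ≡ 1 ⊎ ∃[ u ] y ≡ 2 + (1 + v + u) * 3
  classify : ∀ {y} → SmallValue (2 + (1 + v) * 3) y → Class y
  classify at-0  = inj₁ refl
  classify at-1  = inj₂ (inj₁ refl)
  classify at-−1 = inj₂ (inj₂ (0 , at-−1-≡ v))
    where
    at-−1-≡ : ∀ v → 2 + (1 + v) * 3 ≡ 2 + (1 + v + 0) * 3
    at-−1-≡ = solve-∀
  classify at-2  = inj₂ (inj₂ (1 , at-2-≡ v))
    where
    at-2-≡ : ∀ v → 3 + (2 + (1 + v) * 3) ≡ 2 + (1 + v + 1) * 3
    at-2-≡ = solve-∀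
  too-large : ∀ v a b T → (1 + v + a) + (1 + v + b) + T ≡ (v * 2 + 2) + (a + b + T)
  too-large = solve-∀
  impossible : ∀ {y₀ y₁} T → T ≤ v * 2 + 1 → Class y₀ → Class y₁ → y₀ + (y₁ + T * 3) ≡ 1 + (v * 2 + 2) * 3 → ⊥
  impossible T T≤k (inj₁ refl) (inj₁ refl) eq
    with () ← residues-≡ 0 1 T (v * 2 + 2) eq
  impossible T T≤k (inj₁ refl) (inj₂ (inj₁ refl)) eq =
    <-irrefl (quotients-≡ 1 T (v * 2 + 2) eq) (≤-<-trans T≤k (+-monoʳ-< (v * 2) ≤-refl))
  impossible T T≤k (inj₁ refl) (inj₂ (inj₂ (b , refl))) eq
    with () ← residues-≡ 2 1 (1 + v + b + T) (v * 2 + 2) (trans (sym (collect 0 2 0 (1 + v + b) T)) eq)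
  impossible T T≤k (inj₂ (inj₁ refl)) (inj₁ refl) eq =
    <-irrefl (quotients-≡ 1 T (v * 2 + 2) eq) (≤-<-trans T≤k (+-monoʳ-< (v * 2) ≤-refl))
  impossible T T≤k (inj₂ (inj₁ refl)) (inj₂ (inj₁ refl)) eq
    with () ← residues-≡ 2 1 T (v * 2 + 2) eq
  impossible T T≤k (inj₂ (inj₁ refl)) (inj₂ (inj₂ (b , refl))) eq
    with () ← residues-≡ 3 1 (1 + v + b + T) (v * 2 + 2) (trans (sym (collect 1 2 0 (1 + v + b) T)) eq)
  impossible T T≤k (inj₂ (inj₂ (a , refl))) (inj₁ refl) eq
    with () ← residues-≡ 2 1 (1 + v + a + 0 + T) (v * 2 + 2) (trans (sym (collect 2 0 (1 + v + a) 0 T)) eq)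
  impossible T T≤k (inj₂ (inj₂ (a , refl))) (inj₂ (inj₁ refl)) eq
    with () ← residues-≡ 3 1 (1 + v + a + 0 + T) (v * 2 + 2) (trans (sym (collect 2 1 (1 + v + a) 0 T)) eq)
  -- Both n and 2 + 2 are 1 modulo 3, so size must decide: the two values give at least 2r = 2m - 6
  -- > n. The `suc` is the carry in 2 + 2 = 1 + 3.
  impossible T T≤k (inj₂ (inj₂ (a , refl))) (inj₂ (inj₂ (b , refl))) eq =
    <-irrefl (sym (quotients-≡ 1 (suc ((1 + v + a) + (1 + v + b) + T)) (v * 2 + 2)
                    (trans (sym (collect 2 2 (1 + v + a) (1 + v + b) T)) eq)))
      (s≤s (≤-trans (m≤m+n _ (a + b + T)) (≤-reflexive (sym (too-large v a b T)))))

-- The one integer gained beyond 3k + 2 raises the bound on γ from 2m - 10 to 2m - 9.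
represents-≤3k+3-m≡2 : ∀ v n → n ≤ (v * 2 + 2) * 3 →
  Represents (3 + (2 + (1 + v) * 3)) (1,1,3… (v * 2 + 1)) n
represents-≤3k+3-m≡2 v n n≤ with m≤n⇒m<n∨m≡n n≤
... | inj₁ n< = represents-≤3k+2 (2 + (1 + v) * 3) (v * 2 + 1) n (s≤s⁻¹ (≤-trans n< (≤-reflexive (3k+3 v))))
  where
  3k+3 : ∀ v → (v * 2 + 2) * 3 ≡ suc ((v * 2 + 1) * 3 + 2)
  3k+3 = solve-∀
-- x₀ = -1 gives r = m - 3 and x₁ = 1 gives 1. The remaining m - 8 equals 3v, so T = v.
... | inj₂ refl = subst (Represents (3 + r) (1,1,3… (v * 2 + 1))) (2m-10 v)
    (represents r (v * 2 + 1) -[1+ 0 ] (+ 1) r 1 v (P-−1 r) (P-1 r) (≤-trans (m≤m*n v 2) (m≤m+n (v * 2) 1)))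
  where
  r = 2 + (1 + v) * 3
  2m-10 : ∀ v → 2 + (1 + v) * 3 + (1 + v * 3) ≡ (v * 2 + 2) * 3
  2m-10 = solve-∀

-- Lower bounds for γ

-- If γ ≤ N, the form would pass the test up to γ and so be universal, yet it misses n.
missed⇒<γ : ∀ m γ k N n → DecidesUniversality m γ →
  (∀ i → i ≤ N → Represents m (1,1,3… k) i) → 1 ≤ n → ¬ Represents m (1,1,3… k) n → N < γ
missed⇒<γ m γ k N n decides upTo-N 1≤n missed =
  ≰⇒> λ γ≤N → missed (Equivalence.from (decides (2 + k) (s≤s z≤n) (1,1,3… k) (1,1,3…-positive k))
                        (λ i _ i≤γ → upTo-N i (≤-trans i≤γ γ≤N)) n 1≤n)

-- Writing m as c + 3 (2 + v) makes the residue a numeral in each clause and lets m compute to 3 +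
-- r.
γ-bound : ∀ {γ} c v → c < 3 → DecidesUniversality (c + (2 + v) * 3) γ →
  (c ≢ 2 → 3 * (c + (2 + v) * 3) ∸ 12 ≤ γ) × (c ≡ 2 → 2 * (c + (2 + v) * 3) ∸ 9 ≤ γ)
γ-bound {γ} 0 v _ decides = (λ _ → m≤n+o⇒m∸n≤o _ 12 (begin
    3 * ((2 + v) * 3)        ≡⟨ 3m v ⟩
    -- The bound comes from the unbroken run up to 3k + 2 = 3m - 13; the missed 3m - 10 refutes
    -- universality.
    12 + suc (k * 3 + 2)     ≤⟨ +-monoʳ-≤ 12 (missed⇒<γ (3 + r) γ k (k * 3 + 2) (2 + (v * 3 + 2) * 3)
                                  decides (represents-≤3k+2 r k) (s≤s z≤n) (misses-m≡0 v)) ⟩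
    12 + γ                   ∎)) , λ ()
  where
  open ≤-Reasoning
  r = (1 + v) * 3
  k = v * 3 + 1
  3m : ∀ v → 3 * ((2 + v) * 3) ≡ 12 + suc ((v * 3 + 1) * 3 + 2)
  3m = solve-∀
γ-bound {γ} 1 v _ decides = (λ _ → m≤n+o⇒m∸n≤o _ 12 (begin
    3 * (1 + (2 + v) * 3)    ≡⟨ 3m v ⟩
    12 + suc (k * 3 + 2)     ≤⟨ +-monoʳ-≤ 12 (missed⇒<γ (3 + r) γ k (k * 3 + 2) ((v * 3 + 3) * 3)
                                  decides (represents-≤3k+2 r k) 1≤n (misses-m≡1 v)) ⟩
    12 + γ                   ∎)) , λ ()
  where
  open ≤-Reasoning
  r = 1 + (1 + v) * 3
  k = v * 3 + 2
  3m : ∀ v → 3 * (1 + (2 + v) * 3) ≡ 12 + suc ((v * 3 + 2) * 3 + 2)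
  3m = solve-∀
  1≤n : 1 ≤ (v * 3 + 3) * 3
  1≤n = ≤-trans (≤-trans (s≤s z≤n) (m≤n+m 3 (v * 3))) (m≤m*n (v * 3 + 3) 3)
γ-bound {γ} 2 v _ decides = contradiction refl , λ _ → m≤n+o⇒m∸n≤o _ 9 (begin
    2 * (2 + (2 + v) * 3)    ≡⟨ 2m v ⟩
    9 + suc N                ≤⟨ +-monoʳ-≤ 9 (missed⇒<γ (3 + (2 + (1 + v) * 3)) γ (v * 2 + 1) N (suc N)
                                  decides (represents-≤3k+3-m≡2 v) (s≤s z≤n) (misses-m≡2 v)) ⟩
    9 + γ                    ∎)
  where
  open ≤-Reasoning
  N = (v * 2 + 2) * 3
  2m : ∀ v → 2 * (2 + (2 + v) * 3) ≡ 9 + suc ((v * 2 + 2) * 3)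
  2m = solve-∀
γ-bound (suc (suc (suc _))) v (s≤s (s≤s (s≤s ())))

corollary1p2 : ∀ (m : ℕ) → 14 ≤ m → ∀ (γ : ℕ) → IsGamma m γ →
    (m % 3 ≢ 2 → 3 * m ∸ 12 ≤ γ) × (m % 3 ≡ 2 → 2 * m ∸ 9 ≤ γ)
corollary1p2 m 14≤m γ (_ , decides , _) =
  subst (λ m′ → (m % 3 ≢ 2 → 3 * m′ ∸ 12 ≤ γ) × (m % 3 ≡ 2 → 2 * m′ ∸ 9 ≤ γ)) (sym m≡)
    (γ-bound (m % 3) (m / 3 ∸ 2) (m%n<n m 3) (subst (λ m′ → DecidesUniversality m′ γ) m≡ decides))
  where
  2≤m/3 : 2 ≤ m / 3
  -- `14 / 3` computes to 4, so the first inequality is 2 ≤ 4.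
  2≤m/3 = ≤-trans (s≤s (s≤s z≤n)) (/-monoˡ-≤ 3 14≤m)
  m≡ : m ≡ m % 3 + (2 + (m / 3 ∸ 2)) * 3
  m≡ = trans (m≡m%n+[m/n]*n m 3) (cong (λ q → m % 3 + q * 3) (sym (m+[n∸m]≡n 2≤m/3)))
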